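{- The factor complexity of Kimberling's infinite word ${\bf B}$ is $2n$ for $n\ge 1$; that is, for every $n\ge 1$ exactly $2n$ distinct words of length $n$ occur as factors of ${\bf B}$.
   Context: Definition of ${\bf B}$: Let $B_0=00$. Given a binary word $B_i$, factor it into blocks: each letter $1$ is a block by itself, and each maximal run of consecutive $0$'s is a block, which is either $0$ or $00$ (runs of three or more $0$'s never occur). Then $B_{i+1}$ is obtained by replacing each block $0$ by $0$, each block $1$ by $10$, and each block $00$ by $0101$. For example $B_1=0101$, $B_2=010010$, $B_3=0100101100$. For $i\ge 2$, $B_i$ is a prefix of $B_{i+1}$, and ${\bf B}=0100101100\cdots$ is the unique infinite word having all $B_i$, $i\ge 2$, as prefixes. A factor of an infinite word is a finite contiguous block of letters in it; the factor complexity is the function mapping $n$ to the number of distinct factors of length $n$. -}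

module Defs where

open import Data.Digit using (Bit)
open import Data.Fin.Base using (Fin; zero; suc; toℕ; fromℕ<)
open import Data.Fin.Patterns using (0F; 1F)
open import Data.Fin.Properties using (toℕ-fromℕ<; toℕ<n)
open import Data.List.Base
  using (List; []; _∷_; _++_; length; lookup; concatMap; applyUpTo)
open import Data.List.Membership.Propositional using (_∈_)
open import Data.List.Properties using (++-assoc; ++-identityʳ; length-++; ∷-injectiveˡ; ∷-injectiveʳ)
open import Data.List.Relation.Unary.Unique.Propositional using (Unique)
open import Data.Nat.Base using (ℕ; zero; suc; pred; _+_; _≤_; _<_; z≤n; s≤s)
open import Data.Nat.Properties
  using (≤-trans; ≤-total; m≤m+n; +-suc; +-comm; m≤n⇒∃[o]m+o≡n)
open import Data.Product.Base using (Σ; ∃-syntax; _×_; _,_)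
open import Data.Sum.Base using (inj₁; inj₂)
open import Function.Base using (_∘_)
open import Function.Bundles using (_⇔_)
open import Relation.Binary.PropositionalEquality
  using (_≡_; _≢_; refl; sym; trans; cong)

Word : Set
Word = List Bit

ω-Word : Set
ω-Word = ℕ → Bit

data Block : Set where
  [0] [1] [00] : Block

-- Reading 00 greedily yields the maximal runs of 0's as long as 000 does
-- not occur, which B-no-000 below guarantees for the words B i.
blocks : Word → List Block
blocks []            = []
blocks (1F ∷ w)      = [1] ∷ blocks w
blocks (0F ∷ 0F ∷ w) = [00] ∷ blocks w
blocks (0F ∷ [])     = [0] ∷ []
blocks (0F ∷ 1F ∷ w) = [0] ∷ [1] ∷ blocks w

replace : Block → Word
replace [0]  = 0F ∷ []
replace [1]  = 1F ∷ 0F ∷ []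
replace [00] = 0F ∷ 1F ∷ 0F ∷ 1F ∷ []

step : Word → Word
step w = concatMap replace (blocks w)

B : ℕ → Word
B zero    = 0F ∷ 0F ∷ []
B (suc i) = step (B i)

private
  step-no-00-start : ∀ w v → 0F ∷ 0F ∷ v ≢ step w
  step-no-00-start []            v ()
  step-no-00-start (1F ∷ w)      v ()
  step-no-00-start (0F ∷ 0F ∷ w) v ()
  step-no-00-start (0F ∷ [])     v ()
  step-no-00-start (0F ∷ 1F ∷ w) v ()

  step-no-000 : ∀ w u v → u ++ 0F ∷ 0F ∷ 0F ∷ v ≢ step w
  step-no-000 w             []           v eq = step-no-00-start w _ eq
  step-no-000 (1F ∷ w)      (_ ∷ [])     v eq =
    step-no-00-start w _ (∷-injectiveʳ (∷-injectiveʳ eq))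
  step-no-000 (1F ∷ w)      (_ ∷ _ ∷ u)  v eq =
    step-no-000 w u v (∷-injectiveʳ (∷-injectiveʳ eq))
  step-no-000 (0F ∷ 0F ∷ w) (_ ∷ [])             v ()
  step-no-000 (0F ∷ 0F ∷ w) (_ ∷ _ ∷ [])         v ()
  step-no-000 (0F ∷ 0F ∷ w) (_ ∷ _ ∷ _ ∷ [])     v ()
  step-no-000 (0F ∷ 0F ∷ w) (_ ∷ _ ∷ _ ∷ _ ∷ u)  v eq =
    step-no-000 w u v (∷-injectiveʳ (∷-injectiveʳ (∷-injectiveʳ (∷-injectiveʳ eq))))
  step-no-000 (0F ∷ [])     (_ ∷ [])     v ()
  step-no-000 (0F ∷ [])     (_ ∷ _ ∷ u)  v ()
  step-no-000 (0F ∷ 1F ∷ w) (_ ∷ u)      v eq =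
    step-no-000 (1F ∷ w) u v (∷-injectiveʳ eq)

B-no-000 : ∀ i u v → u ++ 0F ∷ 0F ∷ 0F ∷ v ≢ B i
B-no-000 zero    []                  v ()
B-no-000 zero    (_ ∷ [])            v ()
B-no-000 zero    (_ ∷ _ ∷ [])        v ()
B-no-000 zero    (_ ∷ _ ∷ _ ∷ u)     v ()
B-no-000 (suc i) u v eq = step-no-000 (B i) u v eq

private
  step-++-1 : ∀ u v → step (u ++ 1F ∷ v) ≡ step u ++ 1F ∷ 0F ∷ step v
  step-++-1 []            v = refl
  step-++-1 (1F ∷ u)      v = cong (λ z → 1F ∷ 0F ∷ z) (step-++-1 u v)
  step-++-1 (0F ∷ 0F ∷ u) v = cong (λ z → 0F ∷ 1F ∷ 0F ∷ 1F ∷ z) (step-++-1 u v)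
  step-++-1 (0F ∷ [])     v = refl
  step-++-1 (0F ∷ 1F ∷ u) v = cong (λ z → 0F ∷ 1F ∷ 0F ∷ z) (step-++-1 u v)

  B-suc : ∀ i → ∃[ v ] B (3 + i) ≡ B (2 + i) ++ 1F ∷ v
  B-suc zero    = _ , refl
  B-suc (suc i) with v , eq ← B-suc i = _ , trans (cong step eq) (step-++-1 (B (2 + i)) v)

  B-+ : ∀ i d → ∃[ v ] B (2 + (i + d)) ≡ B (2 + i) ++ v
  B-+ i zero    rewrite +-comm i 0 = [] , sym (++-identityʳ _)
  B-+ i (suc d) rewrite +-suc i d
    with v , eq ← B-+ i d | v′ , eq′ ← B-suc (i + d)
    = v ++ 1F ∷ v′ , trans eq′ (trans (cong (_++ 1F ∷ v′) eq) (++-assoc (B (2 + i)) v _))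

B-long : ∀ n → n < length (B (2 + n))
B-long zero    = s≤s z≤n
B-long (suc n) with v , eq ← B-suc n
  rewrite eq | length-++ (B (2 + n)) {1F ∷ v} | +-suc (length (B (2 + n))) (length v)
  = s≤s (≤-trans (B-long n) (m≤m+n _ _))

-- For i ≥ 2 the words B i are nested prefixes, so letter n can be read off any
-- of them that is long enough; B-prefix and 𝐁-unique show that 𝐁 is the one
-- infinite word having them all as prefixes.
𝐁 : ω-Word
𝐁 n = lookup (B (2 + n)) (fromℕ< (B-long n))

factorAt : ω-Word → ℕ → ℕ → Word
factorAt x p n = applyUpTo (λ j → x (p + j)) n

IsPrefix : Word → ω-Word → Set
IsPrefix w x = w ≡ factorAt x 0 (length w)

IsFactor : Word → ω-Word → Set
IsFactor w x = ∃[ p ] w ≡ factorAt x p (length w)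

private
  lookup-++ : ∀ (u v : Word) (i : Fin (length u)) (j : Fin (length (u ++ v))) →
              toℕ i ≡ toℕ j → lookup u i ≡ lookup (u ++ v) j
  lookup-++ (a ∷ u) v zero    zero    eq = refl
  lookup-++ (a ∷ u) v (suc i) (suc j) eq = lookup-++ u v i j (cong pred eq)

  lookup-≤ : ∀ {m n} → m ≤ n → ∀ (i : Fin (length (B (2 + m)))) (j : Fin (length (B (2 + n)))) →
             toℕ i ≡ toℕ j → lookup (B (2 + m)) i ≡ lookup (B (2 + n)) j
  lookup-≤ {m} m≤n i j eq with m≤n⇒∃[o]m+o≡n m≤n
  ... | d , refl with v , e ← B-+ m d = go (B (2 + (m + d))) e j eq
    where
    go : ∀ w → w ≡ B (2 + m) ++ v → (j : Fin (length w)) → toℕ i ≡ toℕ j →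
         lookup (B (2 + m)) i ≡ lookup w j
    go _ refl j eq = lookup-++ (B (2 + m)) v i j eq

  lookup-B : ∀ m (i : Fin (length (B (2 + m)))) → lookup (B (2 + m)) i ≡ 𝐁 (toℕ i)
  lookup-B m i with ≤-total m (toℕ i) | toℕ-fromℕ< (B-long (toℕ i))
  ... | inj₁ m≤ | eq = lookup-≤ m≤ i _ (sym eq)
  ... | inj₂ ≤m | eq = sym (lookup-≤ ≤m _ i eq)

  ≡-applyUpTo : ∀ (w : Word) (x : ω-Word) → (∀ i → lookup w i ≡ x (toℕ i)) → w ≡ applyUpTo x (length w)
  ≡-applyUpTo []      x h = refl
  ≡-applyUpTo (a ∷ w) x h
    rewrite sym (h zero) = cong (a ∷_) (≡-applyUpTo w (x ∘ suc) (h ∘ suc))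

  applyUpTo-≡ : ∀ (w : Word) (x : ω-Word) → w ≡ applyUpTo x (length w) → ∀ i → lookup w i ≡ x (toℕ i)
  applyUpTo-≡ (a ∷ w) x eq zero    = ∷-injectiveˡ eq
  applyUpTo-≡ (a ∷ w) x eq (suc i) = applyUpTo-≡ w (x ∘ suc) (∷-injectiveʳ eq) i

B-prefix : ∀ i → 2 ≤ i → IsPrefix (B i) 𝐁
B-prefix (suc (suc m)) (s≤s (s≤s _)) = ≡-applyUpTo (B (2 + m)) 𝐁 (lookup-B m)

𝐁-unique : ∀ x → (∀ i → 2 ≤ i → IsPrefix (B i) x) → ∀ n → x n ≡ 𝐁 n
𝐁-unique x pre n = sym (trans
  (applyUpTo-≡ (B (2 + n)) x (pre (2 + n) (s≤s (s≤s z≤n))) (fromℕ< (B-long n)))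
  (cong x (toℕ-fromℕ< (B-long n))))

-- The factor complexity of x takes the value k at n.
FactorComplexity : ω-Word → ℕ → ℕ → Set
FactorComplexity x n k =
  Σ (List Word) λ ws →
    Unique ws × length ws ≡ k × (∀ w → w ∈ ws ⇔ (length w ≡ n × IsFactor w x))

{-# OPTIONS --safe #-}
module Submission where

open import Data.Digit using (Bit)
open import Data.Empty using (⊥; ⊥-elim)
open import Data.Fin.Base using (Fin)
open import Data.Fin.Patterns using (0F; 1F; 2F)
open import Data.Fin.Properties using (_≟_)
open import Data.List.Base
  using (List; []; _∷_; _++_; length; map; applyUpTo; take; drop; foldl; initLast; _∷ʳ′_)
open import Data.List.Membership.Propositional using (_∈_)
open import Data.List.Membership.Propositional.Properties using (∈-∃++; ∈-map⁺; ∈-map⁻)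
open import Data.List.Properties
  using (++-assoc; ++-identityʳ; ++-cancelˡ; ∷-injective; ∷-injectiveˡ; ∷-injectiveʳ;
         ∷ʳ-injective; foldl-++; length-++; length-map; length-applyUpTo)
open import Data.List.Relation.Binary.Permutation.Propositional
  using (_↭_; ↭-sym; ↭-trans; ↭-prep; ↭⇒↭ₛ)
open import Data.List.Relation.Binary.Permutation.Propositional.Properties
  using (∈-resp-↭; ↭-length; shift)
open import Data.List.Relation.Binary.Permutation.Setoid.Properties using (Unique-resp-↭)
open import Data.List.Relation.Unary.All as All using (All; []; _∷_)
import Data.List.Relation.Unary.All.Properties as All
open import Data.List.Relation.Unary.AllPairs as AllPairs using ([]; _∷_)
open import Data.List.Relation.Unary.Any using (here; there)
open import Data.List.Relation.Unary.Unique.Propositional using (Unique)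
import Data.List.Relation.Unary.Unique.Propositional.Properties as Unique
open import Data.Nat.Base using (ℕ; zero; suc; _+_; _*_; _≤_; _<_; z≤n; s≤s)
open import Data.Nat.Properties
  using (suc-injective; *-suc; ≤-refl; ≤-trans; <⇒≤; m<m+n; m≤n⇒m≤1+n; m≤n⇒∃[o]m+o≡n)
open import Data.Product.Base using (∃₂; ∃-syntax; _×_; _,_; proj₁; proj₂)
open import Data.Sum.Base using (_⊎_; inj₁; inj₂; swap)
open import Function.Base using (_∘_)
open import Function.Bundles using (_⇔_; mk⇔; Equivalence)
open import Relation.Binary.PropositionalEquality
  using (_≡_; _≢_; refl; sym; trans; setoid; cong; cong₂; subst; subst₂)
open import Relation.Nullary using (yes; no; contradiction)
open import Defs

-- Let τ be the Tribonacci morphism 0 → 01, 1 → 02, 2 → 0 with fixed point T,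
-- and μ the coding 0 → 100101, 1 → 10010, 2 → 100.  Cutting B i into blocks
-- amounts to B (2 + i) = 0 μ(τⁱ(1)), so 𝐁 = 0 X with X = μ(T).  Desubstituting
-- τ shows that every left special factor of T is a prefix of T; moreover, if
-- a w c and b w d are factors with a ≠ b and c ≠ d, then w c or w d is a prefix
-- of T.  Since 100 marks the beginnings of the blocks of μ, this carries over
-- to 𝐁: for each n ≥ 1 the left special factors of length n are the
-- prefixes of 𝐁 and of X, two different words.  Hence passing from n to n + 1
-- adds exactly two factors.

-- Prefixes and factors of finite words

record _⊑_ {A : Set} (u w : List A) : Set where
  constructor prefix
  field
    post  : List A
    split : w ≡ u ++ post

record _⊑ⁱ_ {A : Set} (u w : List A) : Set where
  constructor within
  field
    pre   : List A
    post  : List A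
    split : w ≡ pre ++ u ++ post

⊑-trans : ∀ {A : Set} {u v w : List A} → u ⊑ v → v ⊑ w → u ⊑ w
⊑-trans {u = u} (prefix y refl) (prefix z refl) = prefix (y ++ z) (++-assoc u y z)

⊑-refl : ∀ {A : Set} {u : List A} → u ⊑ u
⊑-refl {u = u} = prefix [] (sym (++-identityʳ u))

∷⁺-⊑ : ∀ {A : Set} {u v : List A} a → u ⊑ v → (a ∷ u) ⊑ (a ∷ v)
∷⁺-⊑ a (prefix y eq) = prefix y (cong (a ∷_) eq)

++⁺-⊑ : ∀ {A : Set} x {u v : List A} → u ⊑ v → (x ++ u) ⊑ (x ++ v)
++⁺-⊑ []      p = p
++⁺-⊑ (a ∷ x) p = ∷⁺-⊑ a (++⁺-⊑ x p)

⊑-⊑ⁱ-trans : ∀ {A : Set} {u v w : List A} → u ⊑ v → v ⊑ⁱ w → u ⊑ⁱ w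
⊑-⊑ⁱ-trans {u = u} (prefix y refl) (within x z refl) =
  within x (y ++ z) (cong (x ++_) (++-assoc u y z))

suffix-⊑ⁱ : ∀ {A : Set} (x : List A) {u w} → (x ++ u) ⊑ⁱ w → u ⊑ⁱ w
suffix-⊑ⁱ x {u} (within y z eq) = within (y ++ x) z
  (trans eq (trans (cong (y ++_) (++-assoc x u z)) (sym (++-assoc y x (u ++ z)))))

-- The Tribonacci word T

Word₃ : Set
Word₃ = List (Fin 3)

τ : Word₃ → Word₃
τ []       = []
τ (0F ∷ u) = 0F ∷ 1F ∷ τ u
τ (1F ∷ u) = 0F ∷ 2F ∷ τ u
τ (2F ∷ u) = 0F ∷ τ u

τ-++ : ∀ u v → τ (u ++ v) ≡ τ u ++ τ v
τ-++ []       v = refl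
τ-++ (0F ∷ u) v = cong (λ z → 0F ∷ 1F ∷ z) (τ-++ u v)
τ-++ (1F ∷ u) v = cong (λ z → 0F ∷ 2F ∷ z) (τ-++ u v)
τ-++ (2F ∷ u) v = cong (0F ∷_) (τ-++ u v)

τ^ : ℕ → Fin 3 → Word₃
τ^ zero    a = a ∷ []
τ^ (suc i) a = τ (τ^ i a)

τ^-0 : ∀ i → τ^ (suc i) 0F ≡ τ^ i 0F ++ τ^ i 1F
τ^-0 zero    = refl
τ^-0 (suc i) = trans (cong τ (τ^-0 i)) (τ-++ (τ^ i 0F) (τ^ i 1F))

τ^-1 : ∀ i → τ^ (suc i) 1F ≡ τ^ i 0F ++ τ^ i 2F
τ^-1 zero    = refl
τ^-1 (suc i) = trans (cong τ (τ^-1 i)) (τ-++ (τ^ i 0F) (τ^ i 2F))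

τ^-nonempty : ∀ i a → ∃₂ λ c u → τ^ i a ≡ c ∷ u
τ^-nonempty zero    a = a , [] , refl
τ^-nonempty (suc i) a with τ^ i a | τ^-nonempty i a
... | _ | 0F , _ , refl = _ , _ , refl
... | _ | 1F , _ , refl = _ , _ , refl
... | _ | 2F , _ , refl = _ , _ , refl

-- The infinite word T is never formed; it is present through its prefixes `τ^ i 0F`.
𝐓-Factor 𝐓-Prefix : Word₃ → Set
𝐓-Factor u = ∃[ i ] u ⊑ⁱ τ^ i 0F
𝐓-Prefix u = ∃[ i ] u ⊑ τ^ i 0F

⊑-factor : ∀ {u v} → u ⊑ v → 𝐓-Factor v → 𝐓-Factor u
⊑-factor p (i , q) = i , ⊑-⊑ⁱ-trans p q

suffix-factor : ∀ x {u} → 𝐓-Factor (x ++ u) → 𝐓-Factor u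
suffix-factor x (i , p) = i , suffix-⊑ⁱ x p

-- If `u` is all of `τ^ i 0F`, the next letter comes from the nonempty `τ^ i 1F` that the following
-- iterate appends.
prefix-extend : ∀ {u} → 𝐓-Prefix u → ∃[ c ] 𝐓-Prefix (u ++ c ∷ [])
prefix-extend {u} (i , prefix (c ∷ y) eq) = c , i , prefix y (trans eq (sym (++-assoc u _ y)))
prefix-extend {u} (i , prefix []      eq) with c , y , eq′ ← τ^-nonempty i 1F = c , suc i , prefix y
  (trans (τ^-0 i) (trans (cong₂ _++_ (trans eq (++-identityʳ u)) eq′) (sym (++-assoc u _ y))))

-- Desubstitution needs an image under `τ`. The one iterate not given as such is the word 0, a
-- prefix of its image 01.
factor-τ : ∀ {u} → 𝐓-Factor u → ∃[ i ] u ⊑ⁱ τ (τ^ i 0F)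
factor-τ {u} (zero  , within x y eq) = zero , within x (y ++ 1F ∷ [])
  (trans (cong (_++ 1F ∷ []) eq) (trans (++-assoc x _ _) (cong (x ++_) (++-assoc u y _))))
factor-τ (suc i , p)             = i , p

τ-⊑ : ∀ {u v} → u ⊑ v → τ u ⊑ τ v
τ-⊑ {u} (prefix y refl) = prefix (τ y) (τ-++ u y)

τ-factor : ∀ {u} → 𝐓-Factor u → 𝐓-Factor (τ u)
τ-factor {u} (i , within x y eq) = suc i , within (τ x) (τ y)
  (trans (cong τ eq) (trans (τ-++ x (u ++ y)) (cong (τ x ++_) (τ-++ u y))))

-- Desubstitution of τ

τ-head : ∀ t {a y} → τ t ≡ a ∷ y → a ≡ 0F
τ-head (0F ∷ t) refl = refl
τ-head (1F ∷ t) refl = refl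
τ-head (2F ∷ t) refl = refl

-- Each block is 0 or a 0 followed by one nonzero letter, so nonzero letters are isolated.
τ-adjacent : ∀ t x {a b y} → τ t ≡ x ++ a ∷ b ∷ y → a ≡ 0F ⊎ b ≡ 0F
τ-adjacent []       []          ()
τ-adjacent []       (_ ∷ _)     ()
τ-adjacent (0F ∷ t) []          eq = inj₁ (sym (∷-injectiveˡ eq))
τ-adjacent (0F ∷ t) (_ ∷ [])    eq = inj₂ (τ-head t (∷-injectiveʳ (∷-injectiveʳ eq)))
τ-adjacent (0F ∷ t) (_ ∷ _ ∷ x) eq = τ-adjacent t x (∷-injectiveʳ (∷-injectiveʳ eq))
τ-adjacent (1F ∷ t) []          eq = inj₁ (sym (∷-injectiveˡ eq))
τ-adjacent (1F ∷ t) (_ ∷ [])    eq = inj₂ (τ-head t (∷-injectiveʳ (∷-injectiveʳ eq)))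
τ-adjacent (1F ∷ t) (_ ∷ _ ∷ x) eq = τ-adjacent t x (∷-injectiveʳ (∷-injectiveʳ eq))
τ-adjacent (2F ∷ t) []          eq = inj₁ (sym (∷-injectiveˡ eq))
τ-adjacent (2F ∷ t) (_ ∷ x)     eq = τ-adjacent t x (∷-injectiveʳ eq)

factor-adjacent : ∀ {a b u} → 𝐓-Factor (a ∷ b ∷ u) → a ≡ 0F ⊎ b ≡ 0F
factor-adjacent f with i , within x y eq ← factor-τ f = τ-adjacent (τ^ i 0F) x eq

-- σ a is the last letter of τ (a ∷ []).
σ⁻¹ : Fin 3 → Fin 3
σ⁻¹ 0F = 2F
σ⁻¹ 1F = 0F
σ⁻¹ 2F = 1F

σ⁻¹-injective : ∀ {a b} → σ⁻¹ a ≡ σ⁻¹ b → a ≡ b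
σ⁻¹-injective {0F} {0F} _ = refl
σ⁻¹-injective {0F} {1F} ()
σ⁻¹-injective {0F} {2F} ()
σ⁻¹-injective {1F} {0F} ()
σ⁻¹-injective {1F} {1F} _ = refl
σ⁻¹-injective {1F} {2F} ()
σ⁻¹-injective {2F} {0F} ()
σ⁻¹-injective {2F} {1F} ()
σ⁻¹-injective {2F} {2F} _ = refl

-- In an image under τ, every 0 starts a block, and the letter before it
-- is the last one of the preceding block.
τ-cut : ∀ t x {a z} → τ t ≡ x ++ a ∷ 0F ∷ z →
        ∃₂ λ s t′ → t ≡ s ++ σ⁻¹ a ∷ t′ × τ t′ ≡ 0F ∷ z
τ-cut []       []          ()
τ-cut []       (_ ∷ _)     ()
τ-cut (0F ∷ t) (_ ∷ [])    eq with refl , eq′ ← ∷-injective (∷-injectiveʳ eq) = [] , t , refl , eq′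
τ-cut (0F ∷ t) (_ ∷ _ ∷ x) eq with s , t′ , refl , eq′ ← τ-cut t x (∷-injectiveʳ (∷-injectiveʳ eq))
  = 0F ∷ s , t′ , refl , eq′
τ-cut (1F ∷ t) (_ ∷ [])    eq with refl , eq′ ← ∷-injective (∷-injectiveʳ eq) = [] , t , refl , eq′
τ-cut (1F ∷ t) (_ ∷ _ ∷ x) eq with s , t′ , refl , eq′ ← τ-cut t x (∷-injectiveʳ (∷-injectiveʳ eq))
  = 1F ∷ s , t′ , refl , eq′
τ-cut (2F ∷ t) []          eq with refl , eq′ ← ∷-injective eq = [] , t , refl , eq′
τ-cut (2F ∷ t) (_ ∷ x)     eq with s , t′ , refl , eq′ ← τ-cut t x (∷-injectiveʳ eq)
  = 2F ∷ s , t′ , refl , eq′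

-- dec w reads 0 ∷ w as the image of a word under τ; a final 1 or 2 already
-- determines its block.  Words with two adjacent nonzero letters get junk.
dec : Word₃ → Word₃
dec []           = []
dec (0F ∷ w)     = 2F ∷ dec w
dec (1F ∷ [])    = 0F ∷ []
dec (1F ∷ _ ∷ w) = 0F ∷ dec w
dec (2F ∷ [])    = 1F ∷ []
dec (2F ∷ _ ∷ w) = 1F ∷ dec w

length-dec : ∀ w → length (dec w) ≤ length w
length-dec []           = z≤n
length-dec (0F ∷ w)     = s≤s (length-dec w)
length-dec (1F ∷ [])    = s≤s z≤n
length-dec (1F ∷ _ ∷ w) = s≤s (m≤n⇒m≤1+n (length-dec w))
length-dec (2F ∷ [])    = s≤s z≤n
length-dec (2F ∷ _ ∷ w) = s≤s (m≤n⇒m≤1+n (length-dec w))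

-- If `0F ∷ w` ends in 0, this 0 opens a block that is not yet known and `dec` drops it; the 0
-- appended to `τ (dec w)` makes up for it.
dec-τ : ∀ t w y → τ t ≡ 0F ∷ w ++ y → dec w ⊑ t × (0F ∷ w) ⊑ (τ (dec w) ++ 0F ∷ [])
dec-τ t        []            y eq = prefix t refl , ⊑-refl
dec-τ (0F ∷ t) (_ ∷ [])      y eq with refl ← ∷-injectiveˡ (∷-injectiveʳ eq)
  = prefix t refl , prefix (0F ∷ []) refl
dec-τ (0F ∷ t) (_ ∷ b ∷ w)   y eq with refl , eq′ ← ∷-injective (∷-injectiveʳ eq)
  with refl ← τ-head t eq′ with p , q ← dec-τ t w y eq′
  = ∷⁺-⊑ 0F p , ∷⁺-⊑ 0F (∷⁺-⊑ 1F q)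
dec-τ (1F ∷ t) (_ ∷ [])      y eq with refl ← ∷-injectiveˡ (∷-injectiveʳ eq)
  = prefix t refl , prefix (0F ∷ []) refl
dec-τ (1F ∷ t) (_ ∷ b ∷ w)   y eq with refl , eq′ ← ∷-injective (∷-injectiveʳ eq)
  with refl ← τ-head t eq′ with p , q ← dec-τ t w y eq′
  = ∷⁺-⊑ 1F p , ∷⁺-⊑ 0F (∷⁺-⊑ 2F q)
dec-τ (2F ∷ t) (a ∷ w)       y eq with refl ← τ-head t (∷-injectiveʳ eq)
  with p , q ← dec-τ t w y (∷-injectiveʳ eq)
  = ∷⁺-⊑ 2F p , ∷⁺-⊑ 0F q

-- A nonzero `c` can stand after `0F ∷ w` only if that word ends in the 0 that opens a block. Then
-- every letter `d` put there settles exactly this block, whose letter is `σ⁻¹ d`.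
dec-∷ʳ : ∀ t w {c y} → c ≢ 0F → τ t ≡ 0F ∷ w ++ c ∷ y →
         ∀ d → dec (w ++ d ∷ []) ≡ dec w ++ σ⁻¹ d ∷ []
dec-∷ʳ t        []          c≢0 eq 0F = refl
dec-∷ʳ t        []          c≢0 eq 1F = refl
dec-∷ʳ t        []          c≢0 eq 2F = refl
dec-∷ʳ (0F ∷ t) (_ ∷ [])    c≢0 eq d = contradiction (τ-head t (∷-injectiveʳ (∷-injectiveʳ eq))) c≢0
dec-∷ʳ (0F ∷ t) (_ ∷ b ∷ w) c≢0 eq d with refl , eq′ ← ∷-injective (∷-injectiveʳ eq)
  with refl ← τ-head t eq′ = cong (0F ∷_) (dec-∷ʳ t w c≢0 eq′ d)
dec-∷ʳ (1F ∷ t) (_ ∷ [])    c≢0 eq d = contradiction (τ-head t (∷-injectiveʳ (∷-injectiveʳ eq))) c≢0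
dec-∷ʳ (1F ∷ t) (_ ∷ b ∷ w) c≢0 eq d with refl , eq′ ← ∷-injective (∷-injectiveʳ eq)
  with refl ← τ-head t eq′ = cong (1F ∷_) (dec-∷ʳ t w c≢0 eq′ d)
dec-∷ʳ (2F ∷ t) (a ∷ w)     c≢0 eq d with refl ← τ-head t (∷-injectiveʳ eq)
  = cong (2F ∷_) (dec-∷ʳ t w c≢0 (∷-injectiveʳ eq) d)

factor-cut : ∀ {a w} → 𝐓-Factor (a ∷ 0F ∷ w) →
             ∃₂ λ t y → 𝐓-Factor (σ⁻¹ a ∷ t) × τ t ≡ 0F ∷ w ++ y
factor-cut f with i , within x y eq ← factor-τ f
  with s , t , eq₁ , eq₂ ← τ-cut (τ^ i 0F) x eq
  = t , y , (i , within s [] (trans eq₁ (cong (s ++_) (sym (++-identityʳ _))))) , eq₂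

factor-dec : ∀ {a w} → 𝐓-Factor (a ∷ 0F ∷ w) → 𝐓-Factor (σ⁻¹ a ∷ dec w)
factor-dec {a} {w} f with t , y , g , eq ← factor-cut f = ⊑-factor (∷⁺-⊑ _ (proj₁ (dec-τ t w y eq))) g

-- The factor hypothesis ensures that `dec` really decodes `w`. Extending the prefix `dec w` of T by
-- one more letter supplies the 0 that may be missing, since every block starts with 0.
dec-prefix : ∀ {a w} → 𝐓-Factor (a ∷ 0F ∷ w) → 𝐓-Prefix (dec w) → 𝐓-Prefix (0F ∷ w)
dec-prefix {a} {w} f p with t , y , g , eq ← factor-cut f | c , i , q ← prefix-extend p =
  suc i , ⊑-trans (proj₂ (dec-τ t w y eq)) (⊑-trans (lengthen c) (τ-⊑ q))
  where
  lengthen : ∀ c → (τ (dec w) ++ 0F ∷ []) ⊑ τ (dec w ++ c ∷ [])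
  lengthen c = subst (_ ⊑_) (sym (τ-++ (dec w) (c ∷ []))) (++⁺-⊑ (τ (dec w)) (starts c))
    where
    starts : ∀ c → (0F ∷ []) ⊑ τ (c ∷ [])
    starts 0F = prefix _ refl
    starts 1F = prefix _ refl
    starts 2F = prefix _ refl

-- Left special and bispecial factors of T

second-zero : ∀ {a b e u v} → a ≢ b → 𝐓-Factor (a ∷ e ∷ u) → 𝐓-Factor (b ∷ e ∷ v) → e ≡ 0F
-- At most one of the distinct letters `a` and `b` is 0, and a nonzero letter is followed by 0.
second-zero a≢b f g with factor-adjacent f | factor-adjacent g
... | inj₂ e   | _         = e
... | _        | inj₂ e    = e
... | inj₁ refl | inj₁ refl = contradiction refl a≢b

-- A nonempty left special word starts with 0, and as `σ⁻¹` is injective, decoding the rest yields a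
-- shorter left special word. The bound `n` carries the induction because `dec w` is not a subterm.
T-left-special : ∀ n {a b} w → length w ≤ n → a ≢ b →
                 𝐓-Factor (a ∷ w) → 𝐓-Factor (b ∷ w) → 𝐓-Prefix w
T-left-special n       []      _        a≢b f g = 0 , prefix _ refl
T-left-special (suc n) (e ∷ w) (s≤s le) a≢b f g with refl ← second-zero a≢b f g =
  dec-prefix f (T-left-special n (dec w) (≤-trans (length-dec w) le) (a≢b ∘ σ⁻¹-injective)
    (factor-dec f) (factor-dec g))

-- The induction step of `T-bispecial`, with the induction hypothesis as an argument. Of two
-- distinct last letters one is nonzero, and it can be taken as `c` by exchanging the two factors.
bispecial-dec : ∀ {a b c d} w → c ≢ 0F →
  (𝐓-Factor (σ⁻¹ a ∷ dec w ++ σ⁻¹ c ∷ []) → 𝐓-Factor (σ⁻¹ b ∷ dec w ++ σ⁻¹ d ∷ []) →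
   𝐓-Prefix (dec w ++ σ⁻¹ c ∷ []) ⊎ 𝐓-Prefix (dec w ++ σ⁻¹ d ∷ [])) →
  𝐓-Factor (a ∷ 0F ∷ w ++ c ∷ []) → 𝐓-Factor (b ∷ 0F ∷ w ++ d ∷ []) →
  𝐓-Prefix (0F ∷ w ++ c ∷ []) ⊎ 𝐓-Prefix (0F ∷ w ++ d ∷ [])
bispecial-dec {c = c} {d} w c≢0 ih f g
  with t , y , _ , eq ← factor-cut f
  with dec-eq ← dec-∷ʳ t w c≢0 (trans eq (cong (0F ∷_) (++-assoc w _ y)))
  with ih (subst 𝐓-Factor (cong (_ ∷_) (dec-eq c)) (factor-dec f))
          (subst 𝐓-Factor (cong (_ ∷_) (dec-eq d)) (factor-dec g))
... | inj₁ p = inj₁ (dec-prefix f (subst 𝐓-Prefix (sym (dec-eq c)) p))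
... | inj₂ p = inj₂ (dec-prefix g (subst 𝐓-Prefix (sym (dec-eq d)) p))

T-bispecial : ∀ n {a b c d} w → length w ≤ n → a ≢ b → c ≢ d →
              𝐓-Factor (a ∷ w ++ c ∷ []) → 𝐓-Factor (b ∷ w ++ d ∷ []) →
              𝐓-Prefix (w ++ c ∷ []) ⊎ 𝐓-Prefix (w ++ d ∷ [])
T-bispecial n       []      _        a≢b c≢d f g with factor-adjacent f | factor-adjacent g
... | inj₂ refl | _         = inj₁ (0 , prefix [] refl)
... | _         | inj₂ refl = inj₂ (0 , prefix [] refl)
... | inj₁ refl | inj₁ refl = contradiction refl a≢b
T-bispecial (suc n) {a} {b} {c} {d} (e ∷ w) (s≤s le) a≢b c≢d f g
  with refl ← second-zero a≢b f g with c ≟ 0F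
... | no c≢0   = bispecial-dec w c≢0 (T-bispecial n (dec w) (≤-trans (length-dec w) le)
                   (a≢b ∘ σ⁻¹-injective) (c≢d ∘ σ⁻¹-injective)) f g
... | yes refl = swap (bispecial-dec w (c≢d ∘ sym) (T-bispecial n (dec w) (≤-trans (length-dec w) le)
                   (a≢b ∘ sym ∘ σ⁻¹-injective) (c≢d ∘ sym ∘ σ⁻¹-injective)) g f)

τ-σ⁻¹ : ∀ a u → ∃[ x ] τ (σ⁻¹ a ∷ u) ≡ x ++ a ∷ τ u
τ-σ⁻¹ 0F u = [] , refl
τ-σ⁻¹ 1F u = 0F ∷ [] , refl
τ-σ⁻¹ 2F u = 0F ∷ [] , refl

-- The letter `a` ends the block of `σ⁻¹ a`, so a left extension of one iterate by `σ⁻¹ a` is mapped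
-- to one of the next iterate by `a`.
T-extend-left : ∀ i a → 𝐓-Factor (a ∷ τ^ i 0F)
-- The words 00, 10 and 20 are read off the iterates 0102010010201 and 0102010.
T-extend-left zero    0F = 4 , within (0F ∷ 1F ∷ 0F ∷ 2F ∷ 0F ∷ 1F ∷ []) _ refl
T-extend-left zero    1F = 3 , within (0F ∷ []) _ refl
T-extend-left zero    2F = 3 , within (0F ∷ 1F ∷ 0F ∷ []) _ refl
T-extend-left (suc i) a with x , eq ← τ-σ⁻¹ a (τ^ i 0F) =
  suffix-factor x (subst 𝐓-Factor eq (τ-factor (T-extend-left i (σ⁻¹ a))))

-- The coding μ

μ : Word₃ → Word
μ []       = []
μ (0F ∷ u) = 1F ∷ 0F ∷ 0F ∷ 1F ∷ 0F ∷ 1F ∷ μ u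
μ (1F ∷ u) = 1F ∷ 0F ∷ 0F ∷ 1F ∷ 0F ∷ μ u
μ (2F ∷ u) = 1F ∷ 0F ∷ 0F ∷ μ u

μ-++ : ∀ u v → μ (u ++ v) ≡ μ u ++ μ v
μ-++ []       v = refl
μ-++ (0F ∷ u) v = cong (λ z → 1F ∷ 0F ∷ 0F ∷ 1F ∷ 0F ∷ 1F ∷ z) (μ-++ u v)
μ-++ (1F ∷ u) v = cong (λ z → 1F ∷ 0F ∷ 0F ∷ 1F ∷ 0F ∷ z) (μ-++ u v)
μ-++ (2F ∷ u) v = cong (λ z → 1F ∷ 0F ∷ 0F ∷ z) (μ-++ u v)

-- The block of 1 ends in a lone 0, which `blocks` reads together with what follows; hence the
-- companion `step-0-μ`. As the next block starts with 1, this 0 is never half of a 00.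
step-μ : ∀ u → step (μ u) ≡ μ (τ u)
step-0-μ : ∀ u → step (0F ∷ μ u) ≡ 0F ∷ μ (τ u)

step-μ []       = refl
step-μ (0F ∷ u) = cong (λ z → 1F ∷ 0F ∷ 0F ∷ 1F ∷ 0F ∷ 1F ∷ 1F ∷ 0F ∷ 0F ∷ 1F ∷ 0F ∷ z) (step-μ u)
step-μ (1F ∷ u) = cong (λ z → 1F ∷ 0F ∷ 0F ∷ 1F ∷ 0F ∷ 1F ∷ 1F ∷ 0F ∷ z) (step-0-μ u)
step-μ (2F ∷ u) = cong (λ z → 1F ∷ 0F ∷ 0F ∷ 1F ∷ 0F ∷ 1F ∷ z) (step-μ u)

step-0-μ []       = refl
step-0-μ (0F ∷ u) = cong (0F ∷_) (step-μ (0F ∷ u))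
step-0-μ (1F ∷ u) = cong (0F ∷_) (step-μ (1F ∷ u))
step-0-μ (2F ∷ u) = cong (0F ∷_) (step-μ (2F ∷ u))

B-μ : ∀ i → B (2 + i) ≡ 0F ∷ μ (τ^ i 1F)
B-μ zero    = refl
B-μ (suc i) = trans (cong step (B-μ i)) (step-0-μ (τ^ i 1F))

μ-⊑ : ∀ {u v} → u ⊑ v → μ u ⊑ μ v
μ-⊑ {u} (prefix y refl) = prefix (μ y) (μ-++ u y)

μ-∷ : ∀ a u → ∃[ w ] μ (a ∷ u) ≡ 1F ∷ 0F ∷ 0F ∷ w
μ-∷ 0F u = _ , refl
μ-∷ 1F u = _ , refl
μ-∷ 2F u = _ , refl

μ-head : ∀ t {a w} → μ t ≡ a ∷ w → a ≡ 1F
μ-head (a ∷ t) eq with w , eq′ ← μ-∷ a t = sym (∷-injectiveˡ (trans (sym eq′) eq))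

μ-cut : ∀ t x {z} → μ t ≡ x ++ 1F ∷ 0F ∷ 0F ∷ z →
        ∃₂ λ s t′ → t ≡ s ++ t′ × x ≡ μ s × μ t′ ≡ 1F ∷ 0F ∷ 0F ∷ z
μ-cut t        []               eq = [] , t , refl , refl , eq
μ-cut (0F ∷ t) (_ ∷ [])         ()
μ-cut (0F ∷ t) (_ ∷ _ ∷ [])     ()
μ-cut (0F ∷ t) (_ ∷ _ ∷ _ ∷ []) ()
μ-cut (0F ∷ t) (_ ∷ _ ∷ _ ∷ _ ∷ []) ()
μ-cut (0F ∷ t) (_ ∷ _ ∷ _ ∷ _ ∷ _ ∷ []) eq
  with () ← μ-head t (∷-injectiveʳ (cong (drop 5) eq))
μ-cut (0F ∷ t) (_ ∷ _ ∷ _ ∷ _ ∷ _ ∷ _ ∷ x) eq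
  with refl ← cong (take 6) eq | s , t′ , refl , refl , eq′ ← μ-cut t x (cong (drop 6) eq)
  = 0F ∷ s , t′ , refl , refl , eq′
μ-cut (1F ∷ t) (_ ∷ [])         ()
μ-cut (1F ∷ t) (_ ∷ _ ∷ [])     ()
μ-cut (1F ∷ t) (_ ∷ _ ∷ _ ∷ []) eq
  with () ← μ-head t (cong (drop 5) eq)
μ-cut (1F ∷ t) (_ ∷ _ ∷ _ ∷ _ ∷ []) ()
μ-cut (1F ∷ t) (_ ∷ _ ∷ _ ∷ _ ∷ _ ∷ x) eq
  with refl ← cong (take 5) eq | s , t′ , refl , refl , eq′ ← μ-cut t x (cong (drop 5) eq)
  = 1F ∷ s , t′ , refl , refl , eq′
μ-cut (2F ∷ t) (_ ∷ [])         ()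
μ-cut (2F ∷ t) (_ ∷ _ ∷ [])     ()
μ-cut (2F ∷ t) (_ ∷ _ ∷ _ ∷ x) eq
  with refl ← cong (take 3) eq | s , t′ , refl , refl , eq′ ← μ-cut t x (cong (drop 3) eq)
  = 2F ∷ s , t′ , refl , refl , eq′

-- An automaton that excludes short words

data State : Set where
  s1 s10 s100 s1001 s10010 s100101 dead : State

-- A state names the part of a block that has been read, where a completed
-- block is not told apart from an incomplete one spelled alike: 10010 is the
-- block of 1 or the block of 2 followed by 10.
δ : State → Bit → State
δ s1      0F = s10
δ s10     0F = s100
δ s100    1F = s1001
δ s1001   0F = s10010
δ s10010  0F = s100
δ s10010  1F = s100101
δ s100101 0F = s10
δ s100101 1F = s1
δ _       _  = dead

run : State → Word → State
run = foldl δ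

run-dead : ∀ w → run dead w ≡ dead
run-dead []       = refl
run-dead (0F ∷ w) = run-dead w
run-dead (1F ∷ w) = run-dead w

data BlockEnd : State → Set where
  end0 : BlockEnd s100101
  end1 : BlockEnd s10010
  end2 : BlockEnd s100

-- Whichever block was read last, reading another one leads to the end state of the latter, so
-- images under `μ` never reach `dead`.
run-μ : ∀ {s} t → BlockEnd s → BlockEnd (run s (μ t))
run-μ []       e    = e
run-μ (0F ∷ t) end0 = run-μ t end0
run-μ (0F ∷ t) end1 = run-μ t end0
run-μ (0F ∷ t) end2 = run-μ t end0
run-μ (1F ∷ t) end0 = run-μ t end1
run-μ (1F ∷ t) end1 = run-μ t end1
run-μ (1F ∷ t) end2 = run-μ t end1
run-μ (2F ∷ t) end0 = run-μ t end2
run-μ (2F ∷ t) end1 = run-μ t end2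
run-μ (2F ∷ t) end2 = run-μ t end2

-- 𝐗 is 𝐁 without its first letter, the limit of the words μ (τ^ i 0F).
𝐁-Factor 𝐗-Prefix : Word → Set
𝐁-Factor w = ∃[ i ] w ⊑ⁱ μ (τ^ i 0F)
𝐗-Prefix w = ∃[ i ] w ⊑ μ (τ^ i 0F)

μ-factor : ∀ {u} → 𝐓-Factor u → 𝐁-Factor (μ u)
μ-factor {u} (i , within x y eq) = i , within (μ x) (μ y)
  (trans (cong μ eq) (trans (μ-++ x (u ++ y)) (cong (μ x ++_) (μ-++ u y))))

⊑-𝐁-factor : ∀ {u v} → u ⊑ v → 𝐁-Factor v → 𝐁-Factor u
⊑-𝐁-factor p (i , q) = i , ⊑-⊑ⁱ-trans p q

suffix-𝐁-factor : ∀ x {u} → 𝐁-Factor (x ++ u) → 𝐁-Factor u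
suffix-𝐁-factor x (i , q) = i , suffix-⊑ⁱ x q

-- What precedes `f` is arbitrary, so `f` is required to kill every state. The run starts as though
-- a block of 0 had just been read.
forbidden : ∀ f {w} → (∀ s → run s f ≡ dead) → 𝐁-Factor (f ++ w) → ⊥
forbidden f {w} dies (i , within x y eq) = not-dead (run-μ (τ^ i 0F) end0) (trans (cong (run s100101) eq) dies′)
  where
  not-dead : ∀ {s} → BlockEnd s → s ≢ dead
  not-dead end0 ()
  not-dead end1 ()
  not-dead end2 ()
  dies′ : run s100101 (x ++ (f ++ w) ++ y) ≡ dead
  dies′ rewrite ++-assoc f w y | foldl-++ δ s100101 x (f ++ w ++ y)
    | foldl-++ δ (run s100101 x) f (w ++ y) | dies (run s100101 x) = run-dead (w ++ y)

no-111 : ∀ {w} → 𝐁-Factor (1F ∷ 1F ∷ 1F ∷ w) → ⊥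
no-111 = forbidden (1F ∷ 1F ∷ 1F ∷ []) λ where
  s1 → refl ; s10 → refl ; s100 → refl ; s1001 → refl ; s10010 → refl ; s100101 → refl ; dead → refl

no-1101 : ∀ {w} → 𝐁-Factor (1F ∷ 1F ∷ 0F ∷ 1F ∷ w) → ⊥
no-1101 = forbidden (1F ∷ 1F ∷ 0F ∷ 1F ∷ []) λ where
  s1 → refl ; s10 → refl ; s100 → refl ; s1001 → refl ; s10010 → refl ; s100101 → refl ; dead → refl

no-000 : ∀ {w} → 𝐁-Factor (0F ∷ 0F ∷ 0F ∷ w) → ⊥
no-000 = forbidden (0F ∷ 0F ∷ 0F ∷ []) λ where
  s1 → refl ; s10 → refl ; s100 → refl ; s1001 → refl ; s10010 → refl ; s100101 → refl ; dead → refl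

no-0011 : ∀ {w} → 𝐁-Factor (0F ∷ 0F ∷ 1F ∷ 1F ∷ w) → ⊥
no-0011 = forbidden (0F ∷ 0F ∷ 1F ∷ 1F ∷ []) λ where
  s1 → refl ; s10 → refl ; s100 → refl ; s1001 → refl ; s10010 → refl ; s100101 → refl ; dead → refl

no-10101 : ∀ {w} → 𝐁-Factor (1F ∷ 0F ∷ 1F ∷ 0F ∷ 1F ∷ w) → ⊥
no-10101 = forbidden (1F ∷ 0F ∷ 1F ∷ 0F ∷ 1F ∷ []) λ where
  s1 → refl ; s10 → refl ; s100 → refl ; s1001 → refl ; s10010 → refl ; s100101 → refl ; dead → refl

-- Common prefixes of images under μ

-- Images of diverging words agree for 10010 beyond the common prefix whatever
-- the next blocks are, and for 100101 just when these are those of 0 and 1.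
data Common (t t′ : Word₃) (w : Word) : Set where
  agree   : ∀ v → v ⊑ t → v ⊑ t′ →
            w ⊑ (μ v ++ μ (1F ∷ [])) → Common t t′ w
  split01 : ∀ v → (v ++ 0F ∷ []) ⊑ t → (v ++ 1F ∷ []) ⊑ t′ →
            w ⊑ μ (v ++ 0F ∷ []) → Common t t′ w
  split10 : ∀ v → (v ++ 1F ∷ []) ⊑ t → (v ++ 0F ∷ []) ⊑ t′ →
            w ⊑ μ (v ++ 0F ∷ []) → Common t t′ w

common-∷ : ∀ a {t t′ w} → Common t t′ w → Common (a ∷ t) (a ∷ t′) (μ (a ∷ []) ++ w)
common-∷ a (agree v p q r) = agree (a ∷ v) (∷⁺-⊑ a p) (∷⁺-⊑ a q)
  (subst (_ ⊑_) (trans (sym (++-assoc (μ (a ∷ [])) (μ v) _)) (cong (_++ _) (sym (μ-++ (a ∷ []) v))))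
    (++⁺-⊑ (μ (a ∷ [])) r))
common-∷ a (split01 v p q r) = split01 (a ∷ v) (∷⁺-⊑ a p) (∷⁺-⊑ a q)
  (subst (_ ⊑_) (sym (μ-++ (a ∷ []) (v ++ 0F ∷ []))) (++⁺-⊑ (μ (a ∷ [])) r))
common-∷ a (split10 v p q r) = split10 (a ∷ v) (∷⁺-⊑ a p) (∷⁺-⊑ a q)
  (subst (_ ⊑_) (sym (μ-++ (a ∷ []) (v ++ 0F ∷ []))) (++⁺-⊑ (μ (a ∷ [])) r))

⊑-diverge : ∀ {A : Set} {w : List A} q {a b u v} → a ≢ b →
            w ⊑ (q ++ a ∷ u) → w ⊑ (q ++ b ∷ v) → w ⊑ q
⊑-diverge {w = []}    q       a≢b _ _ = prefix q refl
⊑-diverge {w = c ∷ w} []      a≢b (prefix _ refl) (prefix _ refl) = contradiction refl a≢b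
⊑-diverge {w = c ∷ w} (d ∷ q) a≢b (prefix y eq) (prefix z eq′) with refl ← ∷-injectiveˡ eq =
  ∷⁺-⊑ d (⊑-diverge q a≢b (prefix y (∷-injectiveʳ eq)) (prefix z (∷-injectiveʳ eq′)))

⊑-++⁻ : ∀ {A : Set} {w : List A} p {q} → w ⊑ (p ++ q) → w ⊑ p ⊎ ∃[ v ] w ≡ p ++ v × v ⊑ q
⊑-++⁻ {w = w}     []      h = inj₂ (w , refl , h)
⊑-++⁻ {w = []}    (a ∷ p) h = inj₁ (prefix _ refl)
⊑-++⁻ {w = b ∷ w} (a ∷ p) (prefix y eq) with refl ← ∷-injectiveˡ eq
  with ⊑-++⁻ p (prefix y (∷-injectiveʳ eq))
... | inj₁ h              = inj₁ (∷⁺-⊑ a h)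
... | inj₂ (v , refl , h) = inj₂ (v , refl , h)

-- The images continue as 100101 1 and as 10010 100, which first differ after 100101.
common-01 : ∀ t t′ {w} → w ⊑ μ (0F ∷ t) → w ⊑ μ (1F ∷ t′) → w ⊑ μ (0F ∷ [])
common-01 []      t′       p q = p
common-01 (a ∷ t) []       p q = ⊑-trans q (prefix _ refl)
common-01 (a ∷ t) (b ∷ t′) p q with μ (a ∷ t) | μ-∷ a t | μ (b ∷ t′) | μ-∷ b t′
... | _ | _ , refl | _ | _ , refl = ⊑-diverge (μ (0F ∷ [])) (λ ()) p q

-- The images continue as 100101 and as 100 100, which first differ after 10010; so do those in
-- `common-12`, where the block 10010 is followed by 1.
common-02 : ∀ t t′ {w} → w ⊑ μ (0F ∷ t) → w ⊑ μ (2F ∷ t′) → w ⊑ μ (1F ∷ [])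
common-02 t []       p q = ⊑-trans q (prefix _ refl)
common-02 t (b ∷ t′) p q with μ (b ∷ t′) | μ-∷ b t′
... | _ | _ , refl = ⊑-diverge (μ (1F ∷ [])) (λ ()) p q

common-12 : ∀ t t′ {w} → w ⊑ μ (1F ∷ t) → w ⊑ μ (2F ∷ t′) → w ⊑ μ (1F ∷ [])
common-12 []      t′       p q = p
common-12 (a ∷ t) []       p q = ⊑-trans q (prefix _ refl)
common-12 (a ∷ t) (b ∷ t′) p q with μ (a ∷ t) | μ-∷ a t | μ (b ∷ t′) | μ-∷ b t′
... | _ | _ , refl | _ | _ , refl = ⊑-diverge (μ (1F ∷ [])) (λ ()) p q

common-empty : ∀ {t t′ w} → w ⊑ μ (1F ∷ []) → Common t t′ w
common-empty p = agree [] (prefix _ refl) (prefix _ refl) p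

common-≡ : ∀ a {t t′ w} → (∀ w → w ⊑ μ t → w ⊑ μ t′ → Common t t′ w) →
           w ⊑ μ (a ∷ t) → w ⊑ μ (a ∷ t′) → Common (a ∷ t) (a ∷ t′) w
common-≡ a {t} {t′} ih p (prefix z eq)
  with ⊑-++⁻ (μ (a ∷ [])) (subst (_ ⊑_) (μ-++ (a ∷ []) t) p)
... | inj₁ h              = agree (a ∷ []) (prefix t refl) (prefix t′ refl) (⊑-trans h (prefix _ refl))
... | inj₂ (v , refl , h) = common-∷ a (ih v h (prefix z
  (++-cancelˡ (μ (a ∷ [])) _ _ (trans (sym (μ-++ (a ∷ []) t′)) (trans eq (++-assoc (μ (a ∷ [])) v z))))))

common : ∀ t t′ w → w ⊑ μ t → w ⊑ μ t′ → Common t t′ w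
common []       t′       w p q = common-empty (⊑-trans p (prefix _ refl))
common (_ ∷ _)  []       w p q = common-empty (⊑-trans q (prefix _ refl))
common (0F ∷ t) (0F ∷ t′) w p q = common-≡ 0F (common t t′) p q
common (0F ∷ t) (1F ∷ t′) w p q = split01 [] (prefix t refl) (prefix t′ refl) (common-01 t t′ p q)
common (0F ∷ t) (2F ∷ t′) w p q = common-empty (common-02 t t′ p q)
common (1F ∷ t) (0F ∷ t′) w p q = split10 [] (prefix t refl) (prefix t′ refl) (common-01 t′ t q p)
common (1F ∷ t) (1F ∷ t′) w p q = common-≡ 1F (common t t′) p q
common (1F ∷ t) (2F ∷ t′) w p q = common-empty (common-12 t t′ p q)
common (2F ∷ t) (0F ∷ t′) w p q = common-empty (common-02 t′ t q p)
common (2F ∷ t) (1F ∷ t′) w p q = common-empty (common-12 t′ t q p)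
common (2F ∷ t) (2F ∷ t′) w p q = common-≡ 2F (common t t′) p q

-- Left special words cut at a block boundary

μ-prefix : ∀ {u} → 𝐓-Prefix u → 𝐗-Prefix (μ u)
μ-prefix (i , p) = i , μ-⊑ p

⊑-𝐗-prefix : ∀ {u v} → u ⊑ v → 𝐗-Prefix v → 𝐗-Prefix u
⊑-𝐗-prefix p (i , q) = i , ⊑-trans p q

-- Two further letters of T are taken because the block of 2 is just 100; any two blocks together
-- start with 10010.
𝐗-prefix-10010 : ∀ {u} → 𝐓-Prefix u → 𝐗-Prefix (μ u ++ μ (1F ∷ []))
𝐗-prefix-10010 {u} p with c , q ← prefix-extend p with d , r ← prefix-extend q =
  ⊑-𝐗-prefix (subst ((μ u ++ μ (1F ∷ [])) ⊑_) (sym eq) (++⁺-⊑ (μ u) (starts c d))) (μ-prefix r)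
  where
  eq : μ ((u ++ c ∷ []) ++ d ∷ []) ≡ μ u ++ μ (c ∷ d ∷ [])
  eq = trans (cong μ (++-assoc u (c ∷ []) (d ∷ []))) (μ-++ u (c ∷ d ∷ []))
  starts : ∀ c d → μ (1F ∷ []) ⊑ μ (c ∷ d ∷ [])
  starts 0F d = prefix _ refl
  starts 1F d = prefix _ refl
  starts 2F 0F = prefix _ refl
  starts 2F 1F = prefix _ refl
  starts 2F 2F = prefix _ refl

-- After the block of 1 comes a 1, which completes the block of 0.
𝐗-prefix-0-1 : ∀ {u} → 𝐓-Prefix (u ++ 1F ∷ []) → 𝐗-Prefix (μ (u ++ 0F ∷ []))
𝐗-prefix-0-1 {u} p with c , q ← prefix-extend p =
  ⊑-𝐗-prefix (subst₂ _⊑_ (sym (μ-++ u (0F ∷ []))) (sym eq) (++⁺-⊑ (μ u) (starts c))) (μ-prefix q)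
  where
  eq : μ ((u ++ 1F ∷ []) ++ c ∷ []) ≡ μ u ++ μ (1F ∷ c ∷ [])
  eq = trans (cong μ (++-assoc u (1F ∷ []) (c ∷ []))) (μ-++ u (1F ∷ c ∷ []))
  starts : ∀ c → μ (0F ∷ []) ⊑ μ (1F ∷ c ∷ [])
  starts 0F = prefix _ refl
  starts 1F = prefix _ refl
  starts 2F = prefix _ refl

-- A common prefix `v` of `t` and `t′` is left special, hence a prefix of T. If `t` and `t′` go on
-- with 0 and 1 after `v`, one of these continuations is a prefix of T, and either one makes
-- `μ (v ++ 0F ∷ [])` a prefix of X.
left-special-μ : ∀ {a b t t′ w} → a ≢ b → 𝐓-Factor (a ∷ t) → 𝐓-Factor (b ∷ t′) →
                 w ⊑ μ t → w ⊑ μ t′ → 𝐗-Prefix w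
left-special-μ {t = t} {t′} {w} a≢b f g p q with common t t′ w p q
... | agree v p₁ q₁ r = ⊑-𝐗-prefix r (𝐗-prefix-10010
        (T-left-special _ v ≤-refl a≢b (⊑-factor (∷⁺-⊑ _ p₁) f) (⊑-factor (∷⁺-⊑ _ q₁) g)))
... | split01 v p₁ q₁ r
  with T-bispecial _ v ≤-refl a≢b (λ ()) (⊑-factor (∷⁺-⊑ _ p₁) f) (⊑-factor (∷⁺-⊑ _ q₁) g)
...   | inj₁ h = ⊑-𝐗-prefix r (μ-prefix h)
...   | inj₂ h = ⊑-𝐗-prefix r (𝐗-prefix-0-1 h)
left-special-μ {t = t} {t′} {w} a≢b f g p q | split10 v p₁ q₁ r
  with T-bispecial _ v ≤-refl a≢b (λ ()) (⊑-factor (∷⁺-⊑ _ p₁) f) (⊑-factor (∷⁺-⊑ _ q₁) g)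
...   | inj₁ h = ⊑-𝐗-prefix r (𝐗-prefix-0-1 h)
...   | inj₂ h = ⊑-𝐗-prefix r (μ-prefix h)

-- Left special factors of 𝐁

0≢1 : _≢_ {A = Bit} 0F 1F
0≢1 ()

last penultimate : Fin 3 → Bit
last 0F = 1F
last 1F = 0F
last 2F = 0F
penultimate 0F = 0F
penultimate 1F = 1F
penultimate 2F = 0F

∷ʳ²-injective : ∀ {A : Set} (x y : List A) {a b c d} →
                x ++ a ∷ b ∷ [] ≡ y ++ c ∷ d ∷ [] → a ≡ c × b ≡ d
∷ʳ²-injective x y {a} {b} {c} {d} eq
  with eq′ , b≡d ← ∷ʳ-injective (x ++ a ∷ []) (y ++ c ∷ [])
                     (trans (++-assoc x _ _) (trans eq (sym (++-assoc y _ _))))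
  = proj₂ (∷ʳ-injective x y eq′) , b≡d

block-split : ∀ a → ∃[ x ] μ (a ∷ []) ≡ x ++ penultimate a ∷ last a ∷ []
block-split 0F = 1F ∷ 0F ∷ 0F ∷ 1F ∷ [] , refl
block-split 1F = 1F ∷ 0F ∷ 0F ∷ [] , refl
block-split 2F = 1F ∷ [] , refl

block-ends : ∀ x z a {b c} → x ++ b ∷ c ∷ [] ≡ z ++ μ (a ∷ []) → b ≡ penultimate a × c ≡ last a
block-ends x z a eq with y , eq′ ← block-split a =
  ∷ʳ²-injective x (z ++ y) (trans eq (trans (cong (z ++_) eq′) (sym (++-assoc z y _))))

block-end : ∀ x z a {c} → x ++ c ∷ [] ≡ z ++ μ (a ∷ []) → c ≡ last a
block-end x z a eq with y , eq′ ← block-split a =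
  proj₂ (∷ʳ-injective x (z ++ y ++ penultimate a ∷ [])
    (trans eq (trans (cong (z ++_) (trans eq′ (sym (++-assoc y _ _)))) (sym (++-assoc z _ _)))))

-- The word 100 begins a block. Since `b ∷ r` is nonempty, some block `a` precedes it, and comparing
-- the two endings tells which blocks `a` can be.
𝐁-factor-cut : ∀ b r w → 𝐁-Factor ((b ∷ r) ++ 1F ∷ 0F ∷ 0F ∷ w) →
  ∃₂ λ a t → 𝐓-Factor (a ∷ t) × (1F ∷ 0F ∷ 0F ∷ w) ⊑ μ t ×
  ∃₂ λ x z → x ++ b ∷ r ≡ z ++ μ (a ∷ [])
𝐁-factor-cut b r w (i , within x y eq)
  with s , t , eq₁ , eq₂ , eq₃ ← μ-cut (τ^ i 0F) (x ++ b ∷ r)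
         (trans eq (trans (cong (x ++_) (++-assoc (b ∷ r) _ y)) (sym (++-assoc x (b ∷ r) _))))
  with initLast s
... | [] = ⊥-elim (no-∷ x eq₂)
  where
  no-∷ : ∀ x → x ++ b ∷ r ≢ []
  no-∷ []      ()
  no-∷ (_ ∷ _) ()
... | s′ ∷ʳ′ a = a , t , (i , within s′ [] (trans eq₁ (trans (++-assoc s′ _ t) (cong (s′ ++_) (sym (++-identityʳ _)))))) ,
  prefix y eq₃ , x , μ s′ , trans eq₂ (μ-++ s′ (a ∷ []))

-- The forbidden words force `w` to go on as 100 or as 0100. The blocks before this 100 are then
-- distinct: their last letters differ or, behind a shared 0, their penultimate ones.
left-special : ∀ w → 𝐁-Factor (0F ∷ w) → 𝐁-Factor (1F ∷ w) →
               𝐗-Prefix w ⊎ ∃[ v ] w ≡ 0F ∷ v × 𝐗-Prefix v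
left-special []                      f g = inj₁ (0 , prefix _ refl)
left-special (1F ∷ [])               f g = inj₁ (0 , prefix _ refl)
left-special (1F ∷ 1F ∷ w)           f g = ⊥-elim (no-111 g)
left-special (1F ∷ 0F ∷ [])          f g = inj₁ (0 , prefix _ refl)
left-special (1F ∷ 0F ∷ 1F ∷ w)      f g = ⊥-elim (no-1101 g)
left-special (1F ∷ 0F ∷ 0F ∷ w)      f g
  with a , t , f′ , p , x , z , eq ← 𝐁-factor-cut 0F [] w f
     | b , t′ , g′ , p′ , x′ , z′ , eq′ ← 𝐁-factor-cut 1F [] w g
  = inj₁ (left-special-μ
      (λ a≡b → 0≢1 (trans (block-end x z a eq) (trans (cong last a≡b) (sym (block-end x′ z′ b eq′)))))
      f′ g′ p p′)
left-special (0F ∷ [])               f g = inj₂ (_ , refl , 0 , prefix _ refl)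
left-special (0F ∷ 0F ∷ w)           f g = ⊥-elim (no-000 f)
left-special (0F ∷ 1F ∷ [])          f g = inj₂ (_ , refl , 0 , prefix _ refl)
left-special (0F ∷ 1F ∷ 1F ∷ w)      f g = ⊥-elim (no-0011 f)
left-special (0F ∷ 1F ∷ 0F ∷ [])     f g = inj₂ (_ , refl , 0 , prefix _ refl)
left-special (0F ∷ 1F ∷ 0F ∷ 1F ∷ w) f g = ⊥-elim (no-10101 g)
left-special (0F ∷ 1F ∷ 0F ∷ 0F ∷ w) f g
  with a , t , f′ , p , x , z , eq ← 𝐁-factor-cut 0F (0F ∷ []) w f
     | b , t′ , g′ , p′ , x′ , z′ , eq′ ← 𝐁-factor-cut 1F (0F ∷ []) w g
  = inj₂ (_ , refl , left-special-μ
      (λ a≡b → 0≢1 (trans (proj₁ (block-ends x z a eq))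
        (trans (cong penultimate a≡b) (sym (proj₁ (block-ends x′ z′ b eq′))))))
      f′ g′ p p′)

-- The letters in front are the end of a preceding block: 0 and 00 end 100, while 1 ends 100101 and
-- 10 ends 10010.
𝐗-prefix-extend-left : ∀ {w} a → 𝐗-Prefix w → 𝐁-Factor (a ∷ w) × 𝐁-Factor (a ∷ 0F ∷ w)
𝐗-prefix-extend-left 0F (i , p) =
  ⊑-𝐁-factor (∷⁺-⊑ 0F p) (suffix-𝐁-factor (1F ∷ 0F ∷ []) (μ-factor (T-extend-left i 2F))) ,
  ⊑-𝐁-factor (∷⁺-⊑ 0F (∷⁺-⊑ 0F p)) (suffix-𝐁-factor (1F ∷ []) (μ-factor (T-extend-left i 2F)))
𝐗-prefix-extend-left 1F (i , p) =
  ⊑-𝐁-factor (∷⁺-⊑ 1F p) (suffix-𝐁-factor (1F ∷ 0F ∷ 0F ∷ 1F ∷ 0F ∷ []) (μ-factor (T-extend-left i 0F))) ,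
  ⊑-𝐁-factor (∷⁺-⊑ 1F (∷⁺-⊑ 0F p)) (suffix-𝐁-factor (1F ∷ 0F ∷ 0F ∷ []) (μ-factor (T-extend-left i 1F)))

-- From finite words to positions in 𝐁

applyUpTo-+ : ∀ {A : Set} (f : ℕ → A) m n →
              applyUpTo f (m + n) ≡ applyUpTo f m ++ applyUpTo (λ j → f (m + j)) n
applyUpTo-+ f zero    n = refl
applyUpTo-+ f (suc m) n = cong (f 0 ∷_) (applyUpTo-+ (f ∘ suc) m n)

prefix-factorAt : ∀ x {u v} → u ⊑ v → IsPrefix v x → IsPrefix u x
prefix-factorAt x {[]}    _ _ = refl
prefix-factorAt x {a ∷ u} (prefix y refl) eq =
  cong₂ _∷_ (∷-injectiveˡ eq) (prefix-factorAt (x ∘ suc) (prefix y refl) (∷-injectiveʳ eq))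

infix-factorAt : ∀ x y {u z} → IsPrefix (y ++ u ++ z) x → u ≡ factorAt x (length y) (length u)
infix-factorAt x []      {z = z} eq = prefix-factorAt x (prefix z refl) eq
infix-factorAt x (_ ∷ y) eq = infix-factorAt (x ∘ suc) y (∷-injectiveʳ eq)

𝐁-prefix : ∀ i → IsPrefix (0F ∷ μ (τ^ i 0F)) 𝐁
𝐁-prefix i = prefix-factorAt 𝐁 (prefix (μ (τ^ i 2F)) eq) (B-prefix (3 + i) (s≤s (s≤s z≤n)))
  where
  eq : B (3 + i) ≡ 0F ∷ μ (τ^ i 0F) ++ μ (τ^ i 2F)
  eq = trans (B-μ (suc i)) (cong (0F ∷_) (trans (cong μ (τ^-1 i)) (μ-++ (τ^ i 0F) (τ^ i 2F))))

length-μτ^ : ∀ i → i < length (μ (τ^ i 0F))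
length-μτ^ zero    = s≤s z≤n
length-μτ^ (suc i) with c , u , eq ← τ^-nonempty i 1F with v , eq′ ← μ-∷ c u
  rewrite τ^-0 i | eq | μ-++ (τ^ i 0F) (c ∷ u) | eq′ | length-++ (μ (τ^ i 0F)) {1F ∷ 0F ∷ 0F ∷ v}
  = ≤-trans (s≤s (length-μτ^ i)) (m<m+n _ (s≤s z≤n))

factorAt-⊑ : ∀ x p {m n} → m ≤ n → factorAt x p m ⊑ factorAt x p n
factorAt-⊑ x p {m} m≤n with d , refl ← m≤n⇒∃[o]m+o≡n m≤n = prefix _ (applyUpTo-+ (λ j → x (p + j)) m d)

𝐗-prefix⇒ : ∀ {w} → 𝐗-Prefix w → w ≡ factorAt 𝐁 1 (length w)
𝐗-prefix⇒ (i , p) = ∷-injectiveʳ (prefix-factorAt 𝐁 (∷⁺-⊑ 0F p) (𝐁-prefix i))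

𝐗-prefix⇐ : ∀ n → 𝐗-Prefix (factorAt 𝐁 1 n)
𝐗-prefix⇐ n = n , subst (factorAt 𝐁 1 n ⊑_) (sym (∷-injectiveʳ (𝐁-prefix n)))
                    (factorAt-⊑ 𝐁 1 (<⇒≤ (length-μτ^ n)))

𝐁-factor⇒ : ∀ {w} → 𝐁-Factor w → IsFactor w 𝐁
𝐁-factor⇒ {w} (i , within x y eq) =
  suc (length x) , infix-factorAt 𝐁 (0F ∷ x) (subst (λ v → IsPrefix (0F ∷ v) 𝐁) eq (𝐁-prefix i))

𝐁-factor⇐ : ∀ p n → 𝐁-Factor (factorAt 𝐁 p n)
𝐁-factor⇐ p n = suffix-𝐁-factor (factorAt 𝐁 0 p) (subst 𝐁-Factor (applyUpTo-+ 𝐁 p n) (0-prefix (p + n)))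
  where
  0-prefix : ∀ n → 𝐁-Factor (factorAt 𝐁 0 n)
  0-prefix zero    = 0 , within [] _ refl
  -- A nonempty prefix of `𝐁` is a 0 in front of a prefix of X, and hence one of its left
  -- extensions.
  0-prefix (suc n) = proj₁ (𝐗-prefix-extend-left 0F (𝐗-prefix⇐ n))

factorAt-suc : ∀ x p n → factorAt x p (suc n) ≡ x p ∷ factorAt x (suc p) n
factorAt-suc x zero    n = refl
factorAt-suc x (suc p) n = factorAt-suc (x ∘ suc) p n

factor-tail : ∀ x {a w} → IsFactor (a ∷ w) x → IsFactor w x
factor-tail x {w = w} (p , eq) = suc p , ∷-injectiveʳ (trans eq (factorAt-suc x p (length w)))

-- Counting left extensions

∈⇒↭ : ∀ {A : Set} {v : A} {xs} → v ∈ xs → ∃[ ys ] xs ↭ v ∷ ys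
∈⇒↭ v∈xs with ys , zs , refl ← ∈-∃++ v∈xs = ys ++ zs , shift _ ys zs

All-choice : ∀ {A B : Set} {R : A → B → Set} {ys} → All (λ y → ∃[ x ] R x y) ys →
             ∃[ es ] map proj₂ es ≡ ys × All (λ (x , y) → R x y) es
All-choice []             = [] , refl , []
All-choice ((x , r) ∷ rs) with es , eq , h ← All-choice rs = (x , _) ∷ es , cong (_ ∷_) eq , r ∷ h

-- Every factor of length `suc n` extends a factor of length `n` to the left. Both `p` and `q` have
-- two such extensions and every other factor has exactly one, which gives two factors more.
module _ (x : ω-Word) (n : ℕ) {p q : Word}
  (p≡ : p ≡ factorAt x 0 n) (q≡ : q ≡ factorAt x 1 n) (p≢q : p ≢ q)
  (p-extends : ∀ a → IsFactor (a ∷ p) x) (q-extends : ∀ a → IsFactor (a ∷ q) x)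
  (special : ∀ {w} → length w ≡ n → IsFactor (0F ∷ w) x → IsFactor (1F ∷ w) x → w ≡ p ⊎ w ≡ q)
  where

  private
    Extension : Bit → Word → Set
    Extension a w = length w ≡ n × IsFactor (a ∷ w) x

    cons : Bit × Word → Word
    cons (a , w) = a ∷ w

    length-factorAt : ∀ i → length (factorAt x i n) ≡ n
    length-factorAt i = length-applyUpTo (λ j → x (i + j)) n

    length-p : length p ≡ n
    length-p = trans (cong length p≡) (length-factorAt 0)

    length-q : length q ≡ n
    length-q = trans (cong length q≡) (length-factorAt 1)

    -- An occurrence at a positive position has a letter before it, and the word at position 0 is
    -- `p`.
    extension : ∀ {w} → length w ≡ n → IsFactor w x → w ≢ p → ∃[ a ] Extension a w
    extension refl (zero  , eq) w≢p = contradiction (trans eq (sym p≡)) w≢p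
    extension refl (suc i , eq) w≢p = x i , refl , i , trans (cong (x i ∷_) eq) (sym (factorAt-suc x i n))

    special-pair : ∀ {a b w} → a ≢ b → Extension a w → Extension b w → w ≡ p ⊎ w ≡ q
    special-pair {0F} {0F} a≢b _       _       = contradiction refl a≢b
    special-pair {0F} {1F} _   (l , f) (_ , g) = special l f g
    special-pair {1F} {0F} _   (l , f) (_ , g) = special l g f
    special-pair {1F} {1F} a≢b _       _       = contradiction refl a≢b

    module _ {ws : List Word} (char : ∀ w → w ∈ ws ⇔ (length w ≡ n × IsFactor w x)) where

      split : ∃[ rs ] ws ↭ p ∷ q ∷ rs
      split with ys , ws↭ ← ∈⇒↭ (Equivalence.from (char p) (length-p , factor-tail x (p-extends 0F)))
        with ∈-resp-↭ ws↭ (Equivalence.from (char q) (length-q , factor-tail x (q-extends 0F)))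
      ... | here q≡p = contradiction (sym q≡p) p≢q
      ... | there q∈ys with rs , ys↭ ← ∈⇒↭ q∈ys = rs , ↭-trans ws↭ (↭-prep p ys↭)

      module _ (es : List (Bit × Word)) (ws↭ : ws ↭ p ∷ q ∷ map proj₂ es)
        (unique : Unique (p ∷ q ∷ map proj₂ es)) (extensions : All (λ (a , w) → Extension a w) es) where

        vs : List (Bit × Word)
        vs = (0F , p) ∷ (1F , p) ∷ (0F , q) ∷ (1F , q) ∷ es

        ∉-cons : ∀ {w a} → All (w ≢_) (map proj₂ es) → All ((a , w) ≢_) es
        ∉-cons w∉ = All.map (_∘ cong proj₂) (All.map⁻ w∉)

        p∉ : All (p ≢_) (map proj₂ es)
        p∉ = All.tail (AllPairs.head unique)

        q∉ : All (q ≢_) (map proj₂ es)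
        q∉ = AllPairs.head (AllPairs.tail unique)

        unique-vs : Unique vs
        unique-vs =
          ((λ ()) ∷ p≢q ∘ cong proj₂ ∷ (λ ()) ∷ ∉-cons p∉) ∷
          ((λ ()) ∷ p≢q ∘ cong proj₂ ∷ ∉-cons p∉) ∷
          ((λ ()) ∷ ∉-cons q∉) ∷ ∉-cons q∉ ∷ Unique.map⁻ (AllPairs.tail (AllPairs.tail unique))

        extensions-vs : All (λ (a , w) → Extension a w) vs
        extensions-vs = (length-p , p-extends 0F) ∷ (length-p , p-extends 1F) ∷
                        (length-q , q-extends 0F) ∷ (length-q , q-extends 1F) ∷ extensions

        complete : ∀ {a w} → Extension a w → w ∈ p ∷ q ∷ map proj₂ es → (a , w) ∈ vs
        complete {0F} _ (here refl)         = here refl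
        complete {1F} _ (here refl)         = there (here refl)
        complete {0F} _ (there (here refl)) = there (there (here refl))
        complete {1F} _ (there (here refl)) = there (there (there (here refl)))
        complete {a}  e (there (there w∈))
          with (b , w) , bw∈es , refl ← ∈-map⁻ proj₂ w∈ | a ≟ b
        ... | yes refl = there (there (there (there bw∈es)))
        -- A second left letter besides the chosen `b` would make the word left special, hence `p`
        -- or `q`, which are not among the remaining words.
        ... | no a≢b with special-pair a≢b e (All.lookup extensions bw∈es)
        ...   | inj₁ w≡p = contradiction (sym w≡p) (All.lookup p∉ w∈)
        ...   | inj₂ w≡q = contradiction (sym w≡q) (All.lookup q∉ w∈)

        extended : FactorComplexity x (suc n) (2 + length ws)
        extended = map cons vs , Unique.map⁺ (λ where refl → refl) unique-vs ,
          trans (length-map cons vs)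
            (cong (2 +_) (sym (trans (↭-length ws↭) (cong (2 +_) (length-map proj₂ es))))) ,
          λ w → mk⇔ (sound w) (complete′ w)
          where
          sound : ∀ w → w ∈ map cons vs → length w ≡ suc n × IsFactor w x
          sound w w∈ with _ , aw∈vs , refl ← ∈-map⁻ cons w∈
            with l , f ← All.lookup extensions-vs aw∈vs = cong suc l , f
          complete′ : ∀ w → length w ≡ suc n × IsFactor w x → w ∈ map cons vs
          complete′ (a ∷ w) (l , f) = ∈-map⁺ cons (complete (suc-injective l , f)
            (∈-resp-↭ ws↭ (Equivalence.from (char w) (suc-injective l , factor-tail x f))))

  complexity-suc : ∀ {k} → FactorComplexity x n k → FactorComplexity x (suc n) (2 + k)
  complexity-suc (ws , unique , refl , char)
    with rs , ws↭ ← split char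
    with unique′@((_ ∷ p∉) ∷ _) ← Unique-resp-↭ (setoid Word) (↭⇒↭ₛ ws↭) unique
    with es , refl , extensions ← All-choice (All.tabulate λ {w} w∈rs →
           let l , f = Equivalence.to (char w) (∈-resp-↭ (↭-sym ws↭) (there (there w∈rs)))
           in extension l f (λ w≡p → All.lookup p∉ w∈rs (sym w≡p)))
    = extended char es ws↭ unique′ extensions

-- The factor complexity of 𝐁

𝐁-left-special : ∀ w → IsFactor (0F ∷ w) 𝐁 → IsFactor (1F ∷ w) 𝐁 →
                 w ≡ factorAt 𝐁 0 (length w) ⊎ w ≡ factorAt 𝐁 1 (length w)
𝐁-left-special w f g with left-special w (IsFactor⇒ f) (IsFactor⇒ g)
  where
  IsFactor⇒ : ∀ {w} → IsFactor w 𝐁 → 𝐁-Factor w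
  IsFactor⇒ {w} (p , eq) = subst 𝐁-Factor (sym eq) (𝐁-factor⇐ p (length w))
... | inj₁ h              = inj₂ (𝐗-prefix⇒ h)
... | inj₂ (v , refl , h) = inj₁ (cong (0F ∷_) (𝐗-prefix⇒ h))

theorem5 : ∀ (n : ℕ) → 1 ≤ n → FactorComplexity 𝐁 n (2 * n)
-- The induction starts at length 1, as the prefixes of `𝐁` and of X coincide at length 0. The two
-- letters occur at positions 0 and 1.
theorem5 (suc zero) _ = (0F ∷ []) ∷ (1F ∷ []) ∷ [] , ((λ ()) ∷ []) ∷ [] ∷ [] , refl , λ w → mk⇔ sound (complete w)
  where
  sound : ∀ {w} → w ∈ (0F ∷ []) ∷ (1F ∷ []) ∷ [] → length w ≡ 1 × IsFactor w 𝐁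
  sound (here refl)         = refl , 0 , refl
  sound (there (here refl)) = refl , 1 , refl
  complete : ∀ w → length w ≡ 1 × IsFactor w 𝐁 → w ∈ (0F ∷ []) ∷ (1F ∷ []) ∷ []
  complete (0F ∷ []) _ = here refl
  complete (1F ∷ []) _ = there (here refl)
theorem5 (suc (suc n)) _ = subst (FactorComplexity 𝐁 (2 + n)) (sym (*-suc 2 (suc n)))
  -- Here `p` is 0 followed by the prefix of X of length `n`, and `q` is the prefix of X of length
  -- `suc n`; they differ in their first letters.
  (complexity-suc 𝐁 (suc n) refl refl (λ ())
    (λ a → 𝐁-factor⇒ (proj₂ (𝐗-prefix-extend-left a (𝐗-prefix⇐ n))))
    (λ a → 𝐁-factor⇒ (proj₁ (𝐗-prefix-extend-left a (𝐗-prefix⇐ (suc n)))))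
    (λ {w} l f g → subst (λ m → w ≡ factorAt 𝐁 0 m ⊎ w ≡ factorAt 𝐁 1 m) l (𝐁-left-special w f g))
    (theorem5 (suc n) (s≤s z≤n)))
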